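{- Let $N$, $i$, $k$ be positive integers with $k\le N$ and $N/(i+1)\le k\le N/i$, and suppose $N$ is a multiple of every integer in $[2,i]$. Then $$I_N\!\left(\frac{1}{k}\right)=2+N\sum_{j=1}^{i}\frac{\varphi(j)}{j}-k\,\Phi(i),$$ where $\Phi(i)=\sum_{j=1}^{i}\varphi(j)$.
   Context: $\varphi$ is Euler's totient function and $\Phi(i)=\sum_{j=1}^{i}\varphi(j)$ is the totient summatory function (equivalently $|F_i|-1$). For a positive integer $N$, the Farey sequence of order $N$, $F_N$, is the increasing list of all reduced fractions $h/k$ with $0\le h\le k\le N$ and $\gcd(h,k)=1$; it begins with $0/1$ and ends with $1/1$. For $x\in F_N$, $I_N(x)$ denotes the position of $x$ in $F_N$, indexed starting from $1$ (so $I_N(0/1)=1$). -}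

module Defs where

open import Data.Integer.Base using (+_)
open import Data.Fin.Base using (toℕ)
open import Data.List.Base using (List; applyUpTo; upTo; filter; map; concatMap; foldr; length; sum)
open import Data.List.Membership.Propositional using (_∈_; lose)
open import Data.List.Membership.Propositional.Properties
  using (∈-map⁺; ∈-filter⁺; ∈-concatMap⁺; ∈-upTo⁺)
open import Data.List.Relation.Binary.Permutation.Propositional using (↭-sym)
open import Data.List.Relation.Binary.Permutation.Propositional.Properties using (∈-resp-↭)
open import Data.List.Relation.Unary.Any using (index)
open import Data.List.Sort using (sort; sort-↭)
open import Data.Nat.Base using (ℕ; suc; _≤_; NonZero; s≤s; z≤n)
open import Data.Nat.GCD using (gcd)
open import Data.Nat.Coprimality using (1-coprimeTo; coprime⇒gcd≡1)
open import Data.Nat.Properties using (_≟_)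
open import Data.Rational.Base using (ℚ; 0ℚ; _/_)
import Data.Rational.Base as ℚ
open import Data.Rational.Properties using (≤-decTotalOrder)

[1⋯_] : ℕ → List ℕ
[1⋯ n ] = applyUpTo suc n

φ : ℕ → ℕ
φ n = length (filter (λ m → gcd m n ≟ 1) [1⋯ n ])

Φ : ℕ → ℕ
Φ i = sum (map φ [1⋯ i ])

fromℕ : ℕ → ℚ
fromℕ n = + n / 1

-- Σ_{j=1}^{i} φ(j)/j; the list is indexed by j - 1 so that the
-- denominators are visibly nonzero.
Σφ[j]/j : ℕ → ℚ
Σφ[j]/j i = foldr ℚ._+_ 0ℚ (applyUpTo (λ j-1 → + φ (suc j-1) / suc j-1) i)

reducedFractionsOver : (k : ℕ) .{{_ : NonZero k}} → List ℚ
reducedFractionsOver k =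
  map (λ h → + h / k) (filter (λ h → gcd h k ≟ 1) (upTo (suc k)))

-- Distinct pairs (h , k) with gcd h k ≡ 1 give distinct rationals, so the
-- list being sorted has no repetitions.
reducedFractions : ℕ → List ℚ
reducedFractions N = concatMap (λ k-1 → reducedFractionsOver (suc k-1)) (upTo N)

farey : ℕ → List ℚ
farey N = sort ≤-decTotalOrder (reducedFractions N)

-- 1-based position.  Since the Farey sequence has no repetitions, the
-- result does not depend on the membership proof.
I : (N : ℕ) (x : ℚ) → x ∈ farey N → ℕ
I N x x∈F = suc (toℕ (index x∈F))

1/k∈farey : (N k : ℕ) .{{_ : NonZero k}} → k ≤ N → (+ 1 / k) ∈ farey N
1/k∈farey N k@(suc k-1) k≤N =
  ∈-resp-↭ (↭-sym (sort-↭ ≤-decTotalOrder (reducedFractions N)))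
    (∈-concatMap⁺ (λ d → reducedFractionsOver (suc d))
      (lose (∈-upTo⁺ k≤N)
        (∈-map⁺ (λ h → + h / k)
          (∈-filter⁺ (λ h → gcd h k ≟ 1)
            (∈-upTo⁺ (s≤s (s≤s z≤n)))
            (coprime⇒gcd≡1 (1-coprimeTo k))))))

{-# OPTIONS --safe #-}
-- The elements of F_N below 1/k are the reduced fractions h/m with hk < m ≤ N,
-- and I_N(1/k) exceeds their number by one.  Count them numerator by numerator:
-- h = 0 gives only 0/1, and N ≤ k(i+1) forces h ≤ i.  For 1 ≤ h ≤ i the numbers
-- coprime to h are equidistributed over blocks of length h, and both hk and N
-- are multiples of h, so exactly (N/h - k) φ(h) of the m in (hk, N] are coprime
-- to h.
module Submission where

open import Defs
import Algebra.Properties.CommutativeSemigroup as CommutativeSemigroup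
open import Data.Bool.Base using (true; false; if_then_else_)
open import Data.Fin.Base using (toℕ)
open import Data.Integer.Base using (+_)
import Data.Integer.Base as ℤ
import Data.Integer.Properties as ℤ
open import Data.List.Base using (List; []; _∷_; _++_; applyUpTo; upTo; concat; filter; foldr; length; map)
open import Data.List.Membership.Propositional using (_∈_)
open import Data.List.Membership.Propositional.Properties using (∈-map⁻; ∈-filter⁻)
open import Data.List.Properties using (filter-accept; filter-reject; filter-none; filter-++; length-++; map-applyUpTo; map-upTo)
open import Data.List.Relation.Binary.Disjoint.Propositional using (Disjoint)
open import Data.List.Relation.Binary.Permutation.Propositional using (↭-sym; ↭⇒↭ₛ)
open import Data.List.Relation.Binary.Permutation.Propositional.Properties using (filter-↭; ↭-length)
import Data.List.Relation.Binary.Permutation.Setoid.Properties as ↭ₛ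
import Data.List.Relation.Unary.All as All
import Data.List.Relation.Unary.All.Properties as All
open import Data.List.Relation.Unary.AllPairs using (AllPairs; _∷_)
import Data.List.Relation.Unary.AllPairs as AllPairs
import Data.List.Relation.Unary.AllPairs.Properties as AllPairs
open import Data.List.Relation.Unary.Any using (here; there; index)
open import Data.List.Relation.Unary.Linked.Properties using (Linked⇒AllPairs)
open import Data.List.Relation.Unary.Unique.Propositional using (Unique)
import Data.List.Relation.Unary.Unique.Propositional.Properties as Unique
open import Data.List.Sort using (sort-↭; sort-↗)
open import Data.Nat.Base using (ℕ; zero; suc; _≤_; _<_; NonZero; z≤n; s≤s; s≤s⁻¹)
import Data.Nat.Base as ℕ
open import Data.Nat.Coprimality using (gcd≡1⇒coprime; coprime-divisor)
import Data.Nat.Coprimality as Coprime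
open import Data.Nat.Divisibility using (_∣_; divides; quotient; ∣-antisym; ∣m∣n⇒∣m+n; ∣m+n∣m⇒∣n; 1∣_)
open import Data.Nat.GCD using (gcd; gcd-comm; gcd-greatest; gcd[m,n]∣m; gcd[m,n]∣n; gcd-identityˡ)
import Data.Nat.Properties as ℕ
open import Data.Product.Base using (∃; _×_; _,_; proj₁; proj₂)
open import Data.Rational.Base using (ℚ; 0ℚ; toℚᵘ; _/_; _+_; _-_; _*_) renaming (_≤_ to _≤ℚ_; _<_ to _<ℚ_)
import Data.Rational.Properties as ℚ
open import Data.Rational.Solver renaming (module +-*-Solver to ℚ-Solver)
open import Data.Rational.Unnormalised.Base using (mkℚᵘ; *≡*; *≤*; *<*)
import Data.Rational.Unnormalised.Base as ℚᵘ
import Data.Rational.Unnormalised.Properties as ℚᵘ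
open import Function.Base using (_∘_)
open import Function.Bundles using (_⇔_; mk⇔; module Equivalence)
open import Relation.Binary.PropositionalEquality
open import Relation.Nullary.Decidable using (Dec; does; _×-dec_; does-⇔; dec-false)
open import Relation.Nullary.Negation using (¬_; contradiction)
open import Relation.Unary using (Pred; Decidable)

open CommutativeSemigroup ℕ.+-commutativeSemigroup using (interchange)
open CommutativeSemigroup ℕ.*-commutativeSemigroup using (xy∙z≈xz∙y)

-- Finite sums

-- A fold over `applyUpTo` has the shape of `Σφ[j]/j`, and of `Φ` once its `map` is absorbed.
-- Indices run from 0 to n - 1.
∑ : ℕ → (ℕ → ℕ) → ℕ
∑ n f = foldr ℕ._+_ 0 (applyUpTo f n)

∑-cong : ∀ n {f g} → (∀ j → j < n → f j ≡ g j) → ∑ n f ≡ ∑ n g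
∑-cong zero    f≗g = refl
∑-cong (suc n) f≗g = cong₂ ℕ._+_ (f≗g 0 (s≤s z≤n)) (∑-cong n λ j j<n → f≗g (suc j) (s≤s j<n))

∑-zero : ∀ n {f} → (∀ j → j < n → f j ≡ 0) → ∑ n f ≡ 0
∑-zero zero    f≗0 = refl
∑-zero (suc n) f≗0 = cong₂ ℕ._+_ (f≗0 0 (s≤s z≤n)) (∑-zero n λ j j<n → f≗0 (suc j) (s≤s j<n))

∑-split : ∀ m n f → ∑ (m ℕ.+ n) f ≡ ∑ m f ℕ.+ ∑ n (f ∘ (m ℕ.+_))
∑-split zero    n f = refl
∑-split (suc m) n f = trans (cong (f 0 ℕ.+_) (∑-split m n (f ∘ suc))) (sym (ℕ.+-assoc (f 0) _ _))

∑-distrib-+ : ∀ n f g → ∑ n (λ j → f j ℕ.+ g j) ≡ ∑ n f ℕ.+ ∑ n g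
∑-distrib-+ zero    f g = refl
∑-distrib-+ (suc n) f g = trans (cong (f 0 ℕ.+ g 0 ℕ.+_) (∑-distrib-+ n (f ∘ suc) (g ∘ suc)))
  (interchange (f 0) (g 0) (∑ n (f ∘ suc)) (∑ n (g ∘ suc)))

∑-distribˡ-* : ∀ n c f → ∑ n (λ j → c ℕ.* f j) ≡ c ℕ.* ∑ n f
∑-distribˡ-* zero    c f = sym (ℕ.*-zeroʳ c)
∑-distribˡ-* (suc n) c f = trans (cong (c ℕ.* f 0 ℕ.+_) (∑-distribˡ-* n c (f ∘ suc)))
  (sym (ℕ.*-distribˡ-+ c (f 0) _))

∑-comm : ∀ m n (f : ℕ → ℕ → ℕ) → ∑ m (λ i → ∑ n (f i)) ≡ ∑ n (λ j → ∑ m (λ i → f i j))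
∑-comm zero    n f = sym (∑-zero n λ _ _ → refl)
∑-comm (suc m) n f = trans (cong (∑ n (f 0) ℕ.+_) (∑-comm m n (f ∘ suc)))
  (sym (∑-distrib-+ n (f 0) _))

∑-truncate : ∀ m n f → (∀ j → m ≤ j → f j ≡ 0) → ∑ (m ℕ.+ n) f ≡ ∑ m f
∑-truncate m n f f≗0 = begin
  ∑ (m ℕ.+ n) f                      ≡⟨ ∑-split m n f ⟩
  ∑ m f ℕ.+ ∑ n (f ∘ (m ℕ.+_))       ≡⟨ cong (∑ m f ℕ.+_) (∑-zero n λ j _ → f≗0 _ (ℕ.m≤m+n m j)) ⟩
  ∑ m f ℕ.+ 0                        ≡⟨ ℕ.+-identityʳ _ ⟩
  ∑ m f                              ∎
  where open ≡-Reasoning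

-- Both sums equal the sum over the range m + n. This trades a range of numerators depending on the
-- denominator for a fixed one.
∑-same-support : ∀ m n f → (∀ j → m ≤ j → f j ≡ 0) → (∀ j → n ≤ j → f j ≡ 0) → ∑ m f ≡ ∑ n f
∑-same-support m n f f≗0₁ f≗0₂ = begin
  ∑ m f          ≡⟨ ∑-truncate m n f f≗0₁ ⟨
  ∑ (m ℕ.+ n) f  ≡⟨ cong (λ l → ∑ l f) (ℕ.+-comm m n) ⟩
  ∑ (n ℕ.+ m) f  ≡⟨ ∑-truncate n m f f≗0₂ ⟩
  ∑ n f          ∎
  where open ≡-Reasoning

-- Counting by indicators

𝟙 : ∀ {p} {P : Set p} → Dec P → ℕ
𝟙 P? = if does P? then 1 else 0

𝟙-cong : ∀ {p q} {P : Set p} {Q : Set q} (P? : Dec P) (Q? : Dec Q) → P ⇔ Q → 𝟙 P? ≡ 𝟙 Q?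
𝟙-cong P? Q? P⇔Q = cong (if_then 1 else 0) (does-⇔ P⇔Q P? Q?)

𝟙-false : ∀ {p} {P : Set p} (P? : Dec P) → ¬ P → 𝟙 P? ≡ 0
𝟙-false P? ¬P = cong (if_then 1 else 0) (dec-false P? ¬P)

length-filter-applyUpTo : ∀ {a p} {A : Set a} {P : Pred A p} (P? : Decidable P) f n →
  length (filter P? (applyUpTo f n)) ≡ ∑ n (λ j → 𝟙 (P? (f j)))
length-filter-applyUpTo P? f zero    = refl
length-filter-applyUpTo P? f (suc n) with does (P? (f 0))
... | true  = cong suc (length-filter-applyUpTo P? (f ∘ suc) n)
... | false = length-filter-applyUpTo P? (f ∘ suc) n

-- Fuses the coprimality test on a numerator and the comparison of its fraction with 1/k into one
-- decidable condition on the numerator.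
length-filter-map-filter : ∀ {a b p q} {A : Set a} {B : Set b} {P : Pred A p} {Q : Pred B q}
  (P? : Decidable P) (Q? : Decidable Q) (f : A → B) xs →
  length (filter Q? (map f (filter P? xs))) ≡ length (filter (λ x → P? x ×-dec Q? (f x)) xs)
length-filter-map-filter P? Q? f []       = refl
length-filter-map-filter P? Q? f (x ∷ xs) with does (P? x)
... | false = length-filter-map-filter P? Q? f xs
... | true  with does (Q? (f x))
...   | false = length-filter-map-filter P? Q? f xs
...   | true  = cong suc (length-filter-map-filter P? Q? f xs)

length-filter-concat : ∀ {a p} {A : Set a} {P : Pred A p} (P? : Decidable P) (f : ℕ → List A) n →
  length (filter P? (concat (applyUpTo f n))) ≡ ∑ n (λ j → length (filter P? (f j)))
length-filter-concat P? f zero    = refl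
length-filter-concat P? f (suc n) = begin
  length (filter P? (f 0 ++ rest))                      ≡⟨ cong length (filter-++ P? (f 0) rest) ⟩
  length (filter P? (f 0) ++ filter P? rest)            ≡⟨ length-++ (filter P? (f 0)) ⟩
  length (filter P? (f 0)) ℕ.+ length (filter P? rest)
    ≡⟨ cong (length (filter P? (f 0)) ℕ.+_) (length-filter-concat P? (f ∘ suc) n) ⟩
  ∑ (suc n) (λ j → length (filter P? (f j)))            ∎
  where
  open ≡-Reasoning
  rest = concat (applyUpTo (f ∘ suc) n)

-- Fractions

-- Since `_/_` cancels the gcd, numerator and denominator are recovered only up to `≃`. The
-- cross-multiplication lemmas below rest on this.
toℚᵘ-/ : ∀ a b → toℚᵘ (+ a / suc b) ℚᵘ.≃ mkℚᵘ (+ a) b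
toℚᵘ-/ a b = ℚ.toℚᵘ-fromℚᵘ (mkℚᵘ (+ a) b)

/-injective : ∀ a b c d → + a / suc b ≡ + c / suc d → a ℕ.* suc d ≡ c ℕ.* suc b
/-injective a b c d eq with ℚ./-injective-≃ (mkℚᵘ (+ a) b) (mkℚᵘ (+ c) d) eq
... | *≡* eq′ = ℤ.+-injective (trans (ℤ.pos-* a (suc d)) (trans eq′ (sym (ℤ.pos-* c (suc b)))))

/-cancel-≤ : ∀ a b c d → + a / suc b ≤ℚ + c / suc d → a ℕ.* suc d ≤ c ℕ.* suc b
/-cancel-≤ a b c d le
  with ℚᵘ.≤-respˡ-≃ (toℚᵘ-/ a b) (ℚᵘ.≤-respʳ-≃ (toℚᵘ-/ c d) (ℚ.toℚᵘ-mono-≤ le))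
... | *≤* le′ = ℤ.drop‿+≤+ (subst₂ ℤ._≤_ (sym (ℤ.pos-* a (suc d))) (sym (ℤ.pos-* c (suc b))) le′)

/-<-⇔ : ∀ a b c d → + a / suc b <ℚ + c / suc d ⇔ a ℕ.* suc d < c ℕ.* suc b
/-<-⇔ a b c d = mk⇔ to from
  where
  to : + a / suc b <ℚ + c / suc d → a ℕ.* suc d < c ℕ.* suc b
  to lt with ℚᵘ.<-respˡ-≃ (toℚᵘ-/ a b) (ℚᵘ.<-respʳ-≃ (toℚᵘ-/ c d) (ℚ.toℚᵘ-mono-< lt))
  ... | *<* lt′ = ℤ.drop‿+<+ (subst₂ ℤ._<_ (sym (ℤ.pos-* a (suc d))) (sym (ℤ.pos-* c (suc b))) lt′)

  from : a ℕ.* suc d < c ℕ.* suc b → + a / suc b <ℚ + c / suc d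
  from lt = ℚ.toℚᵘ-cancel-<
    (ℚᵘ.<-respˡ-≃ (ℚᵘ.≃-sym (toℚᵘ-/ a b)) (ℚᵘ.<-respʳ-≃ (ℚᵘ.≃-sym (toℚᵘ-/ c d))
      (*<* (subst₂ ℤ._<_ (ℤ.pos-* a (suc d)) (ℤ.pos-* c (suc b)) (ℤ.+<+ lt)))))

fromℕ-+ : ∀ a b → fromℕ (a ℕ.+ b) ≡ fromℕ a + fromℕ b
fromℕ-+ a b = ℚ.toℚᵘ-injective (begin
  toℚᵘ (fromℕ (a ℕ.+ b))               ≈⟨ toℚᵘ-/ (a ℕ.+ b) 0 ⟩
  mkℚᵘ (+ (a ℕ.+ b)) 0                 ≈⟨ *≡* (cong (ℤ._* + 1) (trans (ℤ.pos-+ a b)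
                                            (sym (cong₂ ℤ._+_ (ℤ.*-identityʳ (+ a)) (ℤ.*-identityʳ (+ b)))))) ⟩
  mkℚᵘ (+ a) 0 ℚᵘ.+ mkℚᵘ (+ b) 0       ≈⟨ ℚᵘ.+-cong (toℚᵘ-/ a 0) (toℚᵘ-/ b 0) ⟨
  toℚᵘ (fromℕ a) ℚᵘ.+ toℚᵘ (fromℕ b)   ≈⟨ ℚ.toℚᵘ-homo-+ (fromℕ a) (fromℕ b) ⟨
  toℚᵘ (fromℕ a + fromℕ b)             ∎)
  where open ℚᵘ.≃-Reasoning

-- The hypothesis is the cross-multiplied form of the conclusion. It covers products of naturals (c
-- = 0) as well as the integers N φ(h)/h.
fromℕ-*-/ : ∀ a b c d → a ℕ.* b ≡ d ℕ.* suc c → fromℕ a * (+ b / suc c) ≡ fromℕ d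
fromℕ-*-/ a b c d ab≡dc = ℚ.toℚᵘ-injective (begin
  toℚᵘ (fromℕ a * (+ b / suc c))             ≈⟨ ℚ.toℚᵘ-homo-* (fromℕ a) (+ b / suc c) ⟩
  toℚᵘ (fromℕ a) ℚᵘ.* toℚᵘ (+ b / suc c)     ≈⟨ ℚᵘ.*-cong (toℚᵘ-/ a 0) (toℚᵘ-/ b c) ⟩
  mkℚᵘ (+ a) 0 ℚᵘ.* mkℚᵘ (+ b) c             ≈⟨ *≡* lemma ⟩
  mkℚᵘ (+ d) 0                               ≈⟨ toℚᵘ-/ d 0 ⟨
  toℚᵘ (fromℕ d)                             ∎)
  where
  open ℚᵘ.≃-Reasoning
  -- Multiplying the denominators 1 and `suc c` leaves `1 * suc c`, which does not reduce to
  -- `suc c`.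
  lemma : (+ a ℤ.* + b) ℤ.* + 1 ≡ + d ℤ.* + (1 ℕ.* suc c)
  lemma = trans (ℤ.*-identityʳ (+ a ℤ.* + b)) (trans (sym (ℤ.pos-* a b))
    (trans (cong +_ (trans ab≡dc (cong (d ℕ.*_) (sym (ℕ.*-identityˡ (suc c)))))) (ℤ.pos-* d _)))

-- The Farey sequence

-- k divides h k′ and is coprime to h, so it divides k′; by symmetry k′ divides k.
reduced-denominator-unique : ∀ h k h′ k′ → gcd h k ≡ 1 → gcd h′ k′ ≡ 1 →
  h ℕ.* k′ ≡ h′ ℕ.* k → k ≡ k′
reduced-denominator-unique h k h′ k′ gcd≡1 gcd′≡1 eq = ∣-antisym
  (coprime-divisor (Coprime.sym (gcd≡1⇒coprime {h} {k} gcd≡1)) (divides h′ eq))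
  (coprime-divisor (Coprime.sym (gcd≡1⇒coprime {h′} {k′} gcd′≡1)) (divides h (sym eq)))

∈-reducedFractionsOver⁻ : ∀ {x} d → x ∈ reducedFractionsOver (suc d) →
  ∃ λ h → gcd h (suc d) ≡ 1 × x ≡ + h / suc d
∈-reducedFractionsOver⁻ d x∈ =
  let h , h∈ , x≡ = ∈-map⁻ (λ h → + h / suc d) x∈
  in h , proj₂ (∈-filter⁻ (λ h → gcd h (suc d) ℕ.≟ 1) {xs = upTo (suc (suc d))} h∈) , x≡

reducedFractionsOver-unique : ∀ d → Unique (reducedFractionsOver (suc d))
reducedFractionsOver-unique d = Unique.map⁺ {f = λ h → + h / suc d}
  (λ {h} {h′} eq → ℕ.*-cancelʳ-≡ h h′ (suc d) (/-injective h d h′ d eq))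
  (Unique.filter⁺ (λ h → gcd h (suc d) ℕ.≟ 1) (Unique.upTo⁺ (suc (suc d))))

reducedFractionsOver-disjoint : ∀ {d e} → d ≢ e →
  Disjoint (reducedFractionsOver (suc d)) (reducedFractionsOver (suc e))
reducedFractionsOver-disjoint {d} {e} d≢e (x∈d , x∈e) =
  let h , gcd≡1 , x≡h/d = ∈-reducedFractionsOver⁻ d x∈d
      h′ , gcd′≡1 , x≡h′/e = ∈-reducedFractionsOver⁻ e x∈e
  in d≢e (ℕ.suc-injective (reduced-denominator-unique h (suc d) h′ (suc e) gcd≡1 gcd′≡1
       (/-injective h d h′ e (trans (sym x≡h/d) x≡h′/e))))

reducedFractions-applyUpTo : ∀ N →
  reducedFractions N ≡ concat (applyUpTo (λ d → reducedFractionsOver (suc d)) N)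
reducedFractions-applyUpTo N = cong concat (map-upTo (λ d → reducedFractionsOver (suc d)) N)

reducedFractions-unique : ∀ N → Unique (reducedFractions N)
reducedFractions-unique N = subst Unique (sym (reducedFractions-applyUpTo N))
  (Unique.concat⁺
    (All.applyUpTo⁺₂ _ N reducedFractionsOver-unique)
    (AllPairs.applyUpTo⁺₁ _ N λ i<j _ → reducedFractionsOver-disjoint (ℕ.<⇒≢ i<j)))

-- Sorting gives a weakly increasing list. Its entries are distinct because a permutation preserves
-- uniqueness, and antisymmetry then makes the order strict.
farey-increasing : ∀ N → AllPairs _<ℚ_ (farey N)
farey-increasing N = AllPairs.zipWith (λ (x≤y , x≢y) → ℚ.≰⇒> (x≢y ∘ ℚ.≤-antisym x≤y))
  ( Linked⇒AllPairs ℚ.≤-trans (sort-↗ ℚ.≤-decTotalOrder (reducedFractions N))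
  , ↭ₛ.Unique-resp-↭ (setoid ℚ) (↭⇒↭ₛ (↭-sym (sort-↭ ℚ.≤-decTotalOrder (reducedFractions N))))
      (reducedFractions-unique N) )

-- In a strictly increasing list the entries before x are exactly those smaller than x: at `here`
-- everything later exceeds x, and at `there` the head counts once.
index-increasing : ∀ {x xs} → AllPairs _<ℚ_ xs → (x∈ : x ∈ xs) →
  toℕ (index x∈) ≡ length (filter (ℚ._<? x) xs)
index-increasing {x} (x< ∷ _) (here refl) = sym (cong length
  (trans (filter-reject (ℚ._<? x) (ℚ.<-irrefl refl))
         (filter-none (ℚ._<? x) (All.map ℚ.<-asym x<))))
index-increasing {x} (y< ∷ xs<) (there x∈) = trans
  (cong suc (index-increasing xs< x∈))
  (sym (cong length (filter-accept (ℚ._<? x) (All.lookup y< x∈))))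

-- A count is invariant under permutation, so it can be taken in the unsorted list. The `suc` is the
-- shift to 1-based positions.
I-count : ∀ N x (x∈ : x ∈ farey N) → I N x x∈ ≡ suc (length (filter (ℚ._<? x) (reducedFractions N)))
I-count N x x∈ = cong suc (trans (index-increasing (farey-increasing N) x∈)
  (↭-length (filter-↭ (ℚ._<? x) (sort-↭ ℚ.≤-decTotalOrder (reducedFractions N)))))

-- Counting denominators for a fixed numerator

gcd-+ : ∀ h n → gcd h (h ℕ.+ n) ≡ gcd h n
gcd-+ h n = ∣-antisym
  (gcd-greatest (gcd[m,n]∣m h (h ℕ.+ n)) (∣m+n∣m⇒∣n (gcd[m,n]∣n h (h ℕ.+ n)) (gcd[m,n]∣m h (h ℕ.+ n))))
  (gcd-greatest (gcd[m,n]∣m h n) (∣m∣n⇒∣m+n (gcd[m,n]∣m h n) (gcd[m,n]∣n h n)))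

φ-∑ : ∀ n → φ n ≡ ∑ n (λ j → 𝟙 (gcd n (suc j) ℕ.≟ 1))
φ-∑ n = trans (length-filter-applyUpTo (λ m → gcd m n ℕ.≟ 1) suc n)
  (∑-cong n λ j _ → cong (λ g → 𝟙 (g ℕ.≟ 1)) (gcd-comm (suc j) n))

-- gcd(h, m) has period h in m, so each of the q blocks of length h contributes φ(h).
∑-coprime-multiple : ∀ q h → ∑ (q ℕ.* h) (λ j → 𝟙 (gcd h (suc j) ℕ.≟ 1)) ≡ q ℕ.* φ h
∑-coprime-multiple zero    h = refl
∑-coprime-multiple (suc q) h = begin
  ∑ (h ℕ.+ q ℕ.* h) f                          ≡⟨ ∑-split h (q ℕ.* h) f ⟩
  ∑ h f ℕ.+ ∑ (q ℕ.* h) (f ∘ (h ℕ.+_))         ≡⟨ cong₂ ℕ._+_ (sym (φ-∑ h)) (∑-cong (q ℕ.* h) λ j _ → periodic j) ⟩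
  φ h ℕ.+ ∑ (q ℕ.* h) f                        ≡⟨ cong (φ h ℕ.+_) (∑-coprime-multiple q h) ⟩
  φ h ℕ.+ q ℕ.* φ h                            ∎
  where
  open ≡-Reasoning
  f : ℕ → ℕ
  f j = 𝟙 (gcd h (suc j) ℕ.≟ 1)
  periodic : ∀ j → f (h ℕ.+ j) ≡ f j
  periodic j = cong (λ g → 𝟙 (g ℕ.≟ 1))
    (trans (cong (gcd h) (sym (ℕ.+-suc h j))) (gcd-+ h (suc j)))

-- Index j stands for the denominator j + 1, so the condition m < j + 1 discards exactly the first m
-- indices. The additive form avoids truncated subtraction.
∑-above : ∀ {p} {P : Pred ℕ p} (P? : Decidable P) {m n} → m ≤ n →
  ∑ n (λ j → 𝟙 (P? j ×-dec m ℕ.<? suc j)) ℕ.+ ∑ m (𝟙 ∘ P?) ≡ ∑ n (𝟙 ∘ P?)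
∑-above P? {m} m≤n with l , refl ← ℕ.m≤n⇒∃[o]m+o≡n m≤n = begin
  ∑ (m ℕ.+ l) above ℕ.+ ∑ m (𝟙 ∘ P?)
    ≡⟨ cong (ℕ._+ ∑ m (𝟙 ∘ P?)) (∑-split m l above) ⟩
  ∑ m above ℕ.+ ∑ l (above ∘ (m ℕ.+_)) ℕ.+ ∑ m (𝟙 ∘ P?)
    ≡⟨ cong (ℕ._+ ∑ m (𝟙 ∘ P?)) (cong₂ ℕ._+_
         (∑-zero m λ j j<m → 𝟙-false (P? j ×-dec m ℕ.<? suc j) λ (_ , m≤j) → ℕ.<⇒≱ j<m (s≤s⁻¹ m≤j))
         (∑-cong l λ j _ → 𝟙-cong (P? (m ℕ.+ j) ×-dec m ℕ.<? suc (m ℕ.+ j)) (P? (m ℕ.+ j))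
           (mk⇔ proj₁ (_, s≤s (ℕ.m≤m+n m j))))) ⟩
  ∑ l (𝟙 ∘ P? ∘ (m ℕ.+_)) ℕ.+ ∑ m (𝟙 ∘ P?)
    ≡⟨ ℕ.+-comm _ (∑ m (𝟙 ∘ P?)) ⟩
  ∑ m (𝟙 ∘ P?) ℕ.+ ∑ l (𝟙 ∘ P? ∘ (m ℕ.+_))
    ≡⟨ ∑-split m l (𝟙 ∘ P?) ⟨
  ∑ (m ℕ.+ l) (𝟙 ∘ P?)  ∎
  where
  open ≡-Reasoning
  above : ℕ → ℕ
  above j = 𝟙 (P? j ×-dec m ℕ.<? suc j)

-- Decides whether h/(d + 1) is in lowest terms and, after cross-multiplication, below 1/k.
below? : ∀ k h d → Dec (gcd h (suc d) ≡ 1 × h ℕ.* k < suc d)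
below? k h d = gcd h (suc d) ℕ.≟ 1 ×-dec h ℕ.* k ℕ.<? suc d

-- As gcd(0, m) = m, the sole contribution is 0/1; that first term evaluates to 1.
denominators-0 : ∀ N k .{{_ : NonZero N}} → ∑ N (𝟙 ∘ below? k 0) ≡ 1
denominators-0 (suc N) k = cong suc
  (∑-zero N λ j _ → 𝟙-false (below? k 0 (suc j))
    λ (gcd≡1 , _) → contradiction (trans (sym (gcd-identityˡ (suc (suc j)))) gcd≡1) λ ())

-- Up to h k there are k φ(h) numbers coprime to h, and up to N = q h there are q φ(h). The
-- denominators sought lie between these two bounds.
denominators : ∀ N k h q → N ≡ q ℕ.* h → h ℕ.* k ≤ N →
  ∑ N (𝟙 ∘ below? k h) ℕ.+ k ℕ.* φ h ≡ q ℕ.* φ h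
denominators N k h q N≡qh hk≤N = begin
  ∑ N (𝟙 ∘ below? k h) ℕ.+ k ℕ.* φ h
    ≡⟨ cong (∑ N (𝟙 ∘ below? k h) ℕ.+_)
         (trans (sym (∑-coprime-multiple k h)) (cong (λ m → ∑ m (𝟙 ∘ coprime?)) (ℕ.*-comm k h))) ⟩
  ∑ N (𝟙 ∘ below? k h) ℕ.+ ∑ (h ℕ.* k) (𝟙 ∘ coprime?)
    ≡⟨ ∑-above coprime? hk≤N ⟩
  ∑ N (𝟙 ∘ coprime?)
    ≡⟨ cong (λ m → ∑ m (𝟙 ∘ coprime?)) N≡qh ⟩
  ∑ (q ℕ.* h) (𝟙 ∘ coprime?)
    ≡⟨ ∑-coprime-multiple q h ⟩
  q ℕ.* φ h ∎
  where
  open ≡-Reasoning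
  coprime? : Decidable (λ j → gcd h (suc j) ≡ 1)
  coprime? j = gcd h (suc j) ℕ.≟ 1

-- Regrouping the fractions below 1/k by numerator

count-below-1/k : ∀ N i k .{{_ : NonZero k}} → N ≤ k ℕ.* suc i →
  length (filter (ℚ._<? (+ 1 / k)) (reducedFractions N)) ≡ ∑ (suc i) (λ h → ∑ N (𝟙 ∘ below? k h))
count-below-1/k N i k@(suc k-1) N≤k[1+i] = begin
  length (filter (ℚ._<? (+ 1 / k)) (reducedFractions N))
    ≡⟨ cong (length ∘ filter (ℚ._<? (+ 1 / k))) (reducedFractions-applyUpTo N) ⟩
  length (filter (ℚ._<? (+ 1 / k)) (concat (applyUpTo (λ d → reducedFractionsOver (suc d)) N)))
    ≡⟨ length-filter-concat (ℚ._<? (+ 1 / k)) _ N ⟩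
  ∑ N (λ d → length (filter (ℚ._<? (+ 1 / k)) (reducedFractionsOver (suc d))))
    ≡⟨ ∑-cong N row ⟩
  ∑ N (λ d → ∑ (suc i) (λ h → 𝟙 (below? k h d)))
    -- The range of h no longer depends on d, so the order of summation can be exchanged.
    ≡⟨ ∑-comm N (suc i) (λ d h → 𝟙 (below? k h d)) ⟩
  ∑ (suc i) (λ h → ∑ N (𝟙 ∘ below? k h))  ∎
  where
  open ≡-Reasoning
  row : ∀ d → d < N →
    length (filter (ℚ._<? (+ 1 / k)) (reducedFractionsOver (suc d))) ≡ ∑ (suc i) (λ h → 𝟙 (below? k h d))
  row d d<N = begin
    length (filter (ℚ._<? (+ 1 / k)) (reducedFractionsOver (suc d)))
      ≡⟨ length-filter-map-filter (λ h → gcd h (suc d) ℕ.≟ 1)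
           (ℚ._<? (+ 1 / k)) (λ h → + h / suc d) (upTo (suc (suc d))) ⟩
    length (filter lowest<1/k? (upTo (suc (suc d))))
      ≡⟨ length-filter-applyUpTo lowest<1/k? (λ h → h) (suc (suc d)) ⟩
    ∑ (suc (suc d)) (𝟙 ∘ lowest<1/k?)
      ≡⟨ ∑-cong (suc (suc d)) (λ h _ → 𝟙-cong (lowest<1/k? h) (below? k h d)
           (mk⇔ (λ (g , lt) → g , subst (h ℕ.* k <_) (ℕ.*-identityˡ (suc d))
                                     (Equivalence.to (/-<-⇔ h d 1 k-1) lt))
                (λ (g , lt) → g , Equivalence.from (/-<-⇔ h d 1 k-1)
                                     (subst (h ℕ.* k <_) (sym (ℕ.*-identityˡ (suc d))) lt)))) ⟩
    ∑ (suc (suc d)) (λ h → 𝟙 (below? k h d))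
      -- Terms vanish beyond either range: h ≥ d + 2 gives h k ≥ h > d + 1, and h > i gives h k ≥ k
      -- (i + 1) ≥ N ≥ d + 1.
      ≡⟨ ∑-same-support (suc (suc d)) (suc i) _
           (λ h d+2≤h → 𝟙-false (below? k h d) λ (_ , hk≤d) →
             ℕ.<⇒≱ hk≤d (ℕ.≤-trans (ℕ.<⇒≤ d+2≤h) (ℕ.m≤m*n h k)))
           (λ h i<h → 𝟙-false (below? k h d) λ (_ , hk≤d) →
             ℕ.<⇒≱ hk≤d (ℕ.≤-trans d<N (ℕ.≤-trans N≤k[1+i]
               (ℕ.≤-trans (ℕ.*-monoʳ-≤ k i<h) (ℕ.≤-reflexive (ℕ.*-comm k h)))))) ⟩
    ∑ (suc i) (λ h → 𝟙 (below? k h d)) ∎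
    where
    lowest<1/k? : Decidable (λ h → gcd h (suc d) ≡ 1 × + h / suc d <ℚ + 1 / k)
    lowest<1/k? h = gcd h (suc d) ℕ.≟ 1 ×-dec (+ h / suc d) ℚ.<? (+ 1 / k)

-- Passing to rational sums

fromℕ-∑ : ∀ n a (f : ℕ → ℕ) (g : ℕ → ℚ) → (∀ j → j < n → fromℕ (f j) ≡ a * g j) →
  fromℕ (∑ n f) ≡ a * foldr _+_ 0ℚ (applyUpTo g n)
fromℕ-∑ zero    a f g eq = sym (ℚ.*-zeroʳ a)
fromℕ-∑ (suc n) a f g eq = begin
  fromℕ (f 0 ℕ.+ ∑ n (f ∘ suc))                            ≡⟨ fromℕ-+ (f 0) (∑ n (f ∘ suc)) ⟩
  fromℕ (f 0) + fromℕ (∑ n (f ∘ suc))                      ≡⟨ cong₂ _+_ (eq 0 (s≤s z≤n))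
      (fromℕ-∑ n a (f ∘ suc) (g ∘ suc) λ j j<n → eq (suc j) (s≤s j<n)) ⟩
  a * g 0 + a * foldr _+_ 0ℚ (applyUpTo (g ∘ suc) n)       ≡⟨ ℚ.*-distribˡ-+ a (g 0) _ ⟨
  a * foldr _+_ 0ℚ (applyUpTo g (suc n))                   ∎
  where open ≡-Reasoning

-- Sums the counts of `denominators` over the numerators 1 to i. The bound k i ≤ N yields h k ≤ N
-- for each of them.
∑-denominators : ∀ N i k → k ℕ.* i ≤ N → (∀ j → 2 ≤ j → j ≤ i → j ∣ N) →
  fromℕ (∑ i (λ h → ∑ N (𝟙 ∘ below? k (suc h)))) + fromℕ k * fromℕ (Φ i) ≡ fromℕ N * Σφ[j]/j i
∑-denominators N i k ki≤N j∣N = begin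
  fromℕ (∑ i c) + fromℕ k * fromℕ (Φ i)      ≡⟨ cong (λ t → fromℕ (∑ i c) + t)
      -- `fromℕ` is a fraction with denominator 1, so the case c = 0 turns the rational product into
      -- a natural one.
      (fromℕ-*-/ k (Φ i) 0 (k ℕ.* Φ i) (sym (ℕ.*-identityʳ _))) ⟩
  fromℕ (∑ i c) + fromℕ (k ℕ.* Φ i)          ≡⟨ fromℕ-+ (∑ i c) (k ℕ.* Φ i) ⟨
  fromℕ (∑ i c ℕ.+ k ℕ.* Φ i)                ≡⟨ cong (λ l → fromℕ (∑ i c ℕ.+ k ℕ.* foldr ℕ._+_ 0 l))
      (map-applyUpTo suc φ i) ⟩
  fromℕ (∑ i c ℕ.+ k ℕ.* ∑ i (φ ∘ suc))      ≡⟨ cong (λ t → fromℕ (∑ i c ℕ.+ t)) (∑-distribˡ-* i k (φ ∘ suc)) ⟨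
  fromℕ (∑ i c ℕ.+ ∑ i (λ h → k ℕ.* φ (suc h)))   ≡⟨ cong fromℕ (∑-distrib-+ i c _) ⟨
  fromℕ (∑ i (λ h → c h ℕ.+ k ℕ.* φ (suc h)))     ≡⟨ fromℕ-∑ i (fromℕ N) _ (λ h → + φ (suc h) / suc h) column ⟩
  fromℕ N * Σφ[j]/j i                        ∎
  where
  open ≡-Reasoning
  c : ℕ → ℕ
  c h = ∑ N (𝟙 ∘ below? k (suc h))

  -- The hypothesis starts at the divisor 2, so the divisor 1 is supplied separately.
  suc∣N : ∀ h → h < i → suc h ∣ N
  suc∣N zero    _   = 1∣ N
  suc∣N (suc h) h<i = j∣N (suc (suc h)) (s≤s (s≤s z≤n)) h<i

  -- With N = q (h + 1), both sides equal q φ(h + 1).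
  column : ∀ h → h < i → fromℕ (c h ℕ.+ k ℕ.* φ (suc h)) ≡ fromℕ N * (+ φ (suc h) / suc h)
  column h h<i = trans
    (cong fromℕ (denominators N k (suc h) q N≡qh
      (ℕ.≤-trans (ℕ.≤-reflexive (ℕ.*-comm (suc h) k)) (ℕ.≤-trans (ℕ.*-monoʳ-≤ k h<i) ki≤N))))
    (sym (fromℕ-*-/ N (φ (suc h)) h (q ℕ.* φ (suc h))
      (trans (cong (ℕ._* φ (suc h)) N≡qh) (xy∙z≈xz∙y q (suc h) (φ (suc h))))))
    where
    q = quotient (suc∣N h h<i)
    N≡qh = _∣_.equality (suc∣N h h<i)

theorem3 : (N i k : ℕ) .{{_ : NonZero N}} .{{_ : NonZero i}} .{{_ : NonZero k}} →
    (k≤N : k ≤ N) →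
    (+ N / suc i) ≤ℚ fromℕ k →
    fromℕ k ≤ℚ (+ N / i) →
    (∀ j → 2 ≤ j → j ≤ i → j ∣ N) →
    fromℕ (I N (+ 1 / k) (1/k∈farey N k k≤N))
    ≡ fromℕ 2 + fromℕ N * Σφ[j]/j i - fromℕ k * fromℕ (Φ i)
theorem3 N i@(suc i-1) k k≤N N/[1+i]≤k k≤N/i j∣N = begin
  fromℕ (I N (+ 1 / k) (1/k∈farey N k k≤N))
    ≡⟨ cong fromℕ (I-count N (+ 1 / k) (1/k∈farey N k k≤N)) ⟩
  fromℕ (suc (length (filter (ℚ._<? (+ 1 / k)) (reducedFractions N))))
    ≡⟨ cong (fromℕ ∘ suc) (count-below-1/k N i k N≤k[1+i]) ⟩
  -- The sum over `suc i` numerators unfolds to its h = 0 term plus `C`.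
  fromℕ (suc (∑ N (𝟙 ∘ below? k 0) ℕ.+ C))
    ≡⟨ cong (λ c → fromℕ (suc (c ℕ.+ C))) (denominators-0 N k) ⟩
  -- The constant 2 is one for the 1-based position and one for the fraction 0/1.
  fromℕ (2 ℕ.+ C)
    ≡⟨ fromℕ-+ 2 C ⟩
  fromℕ 2 + fromℕ C
    -- Adding and subtracting k Φ(i) produces the left-hand side of `∑-denominators`.
    ≡⟨ solve 3 (λ t c p → t :+ c := t :+ (c :+ p) :- p) refl (fromℕ 2) (fromℕ C) (fromℕ k * fromℕ (Φ i)) ⟩
  fromℕ 2 + (fromℕ C + fromℕ k * fromℕ (Φ i)) - fromℕ k * fromℕ (Φ i)
    ≡⟨ cong (λ t → fromℕ 2 + t - fromℕ k * fromℕ (Φ i)) (∑-denominators N i k ki≤N j∣N) ⟩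
  fromℕ 2 + fromℕ N * Σφ[j]/j i - fromℕ k * fromℕ (Φ i) ∎
  where
  open ≡-Reasoning
  open ℚ-Solver
  C = ∑ i (λ h → ∑ N (𝟙 ∘ below? k (suc h)))
  -- The two bounds on k are the rational hypotheses cross-multiplied; the denominator 1 of
  -- `fromℕ k` leaves a factor `N * 1` to remove.
  N≤k[1+i] : N ≤ k ℕ.* suc i
  N≤k[1+i] = subst (_≤ k ℕ.* suc i) (ℕ.*-identityʳ N) (/-cancel-≤ N i k 0 N/[1+i]≤k)
  ki≤N : k ℕ.* i ≤ N
  ki≤N = subst (k ℕ.* i ≤_) (ℕ.*-identityʳ N) (/-cancel-≤ k 0 N i-1 k≤N/i)
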